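{- Let $\mathbb{F}$ be any field, let $G=([n],E)$ be a directed graph and $\mathcal{S}_G=\langle\mathrm{E}_{i,j}\mid (i,j)\in E\rangle\le\mathrm{M}(n,\mathbb{F})$. The maximum number of arcs in an acyclic spanning subgraph of $G$ equals the largest dimension of a nil subspace of $\mathcal{S}_G$.
   Context: Directed graphs have arc sets $E\subseteq[n]\times[n]$, self-loops allowed and counted as cycles (of length $1$); acyclic means containing no directed cycle. A spanning subgraph has vertex set $[n]$ and arc set contained in $E$. $\mathrm{E}_{i,j}$ is the elementary $n\times n$ matrix with $1$ at $(i,j)$. A matrix space is nil if every matrix in it is nilpotent. -}

module Defs where

open import Level using (Level; _⊔_)
open import Data.Nat using (ℕ; zero; suc; _≤_; _+_)
open import Data.Fin using (Fin; zero; suc; inject₁; fromℕ)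
open import Data.Bool using (Bool; true; false; if_then_else_)
open import Data.Product using (Σ; _×_; ∃; ∃-syntax; _,_)
open import Relation.Nullary using (¬_)
open import Relation.Binary.PropositionalEquality using (_≡_)
open import Function.Definitions using (Injective)
open import Algebra.Bundles using (CommutativeRing)
import Algebra.Definitions.RawMonoid as RawMonoidDefs

record Field (c ℓ : Level) : Set (Level.suc (c ⊔ ℓ)) where
  field
    commutativeRing : CommutativeRing c ℓ
  open CommutativeRing commutativeRing public
  field
    1≉0     : ¬ (1# ≈ 0#)
    inverse : ∀ x → ¬ (x ≈ 0#) → ∃[ y ] (x * y ≈ 1#)

IsMaximum : ∀ {p} → (ℕ → Set p) → ℕ → Set p
IsMaximum P m = P m × (∀ k → P k → k ≤ m)

Digraph : ℕ → Set
Digraph n = Fin n → Fin n → Bool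

countTrue : ∀ {k} → (Fin k → Bool) → ℕ
countTrue {zero}  f = 0
countTrue {suc k} f = (if f zero then 1 else 0) + countTrue (λ i → f (suc i))

sumℕ : ∀ {k} → (Fin k → ℕ) → ℕ
sumℕ {zero}  f = 0
sumℕ {suc k} f = f zero + sumℕ (λ i → f (suc i))

arcCount : ∀ {n} → Digraph n → ℕ
arcCount E = sumℕ (λ i → countTrue (E i))

_⊆G_ : ∀ {n} → Digraph n → Digraph n → Set
H ⊆G G = ∀ i j → H i j ≡ true → G i j ≡ true

-- A directed cycle of length k+1 in H: pairwise distinct vertices
-- v 0, …, v k with arcs v i → v (i+1) and v k → v 0.
-- (k = 0 gives a self-loop, a cycle of length 1.)
IsDirectedCycle : ∀ {n} → Digraph n → (k : ℕ) → (Fin (suc k) → Fin n) → Set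
IsDirectedCycle H k v =
  Injective _≡_ _≡_ v ×
  (∀ (i : Fin k) → H (v (inject₁ i)) (v (suc i)) ≡ true) ×
  H (v (fromℕ k)) (v zero) ≡ true

Acyclic : ∀ {n} → Digraph n → Set
Acyclic {n} H = ∀ k (v : Fin (suc k) → Fin n) → ¬ IsDirectedCycle H k v

AcyclicSpanningSize : ∀ {n} → Digraph n → ℕ → Set
AcyclicSpanningSize G m = ∃[ H ] (H ⊆G G × Acyclic H × arcCount H ≡ m)

module Matrices {c ℓ} (𝔽 : Field c ℓ) where
  open Field 𝔽
  open RawMonoidDefs +-rawMonoid using (sum)

  Mat : ℕ → Set c
  Mat n = Fin n → Fin n → Carrier

  _≈M_ : ∀ {n} → Mat n → Mat n → Set ℓ
  A ≈M B = ∀ i j → A i j ≈ B i j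

  0M : ∀ {n} → Mat n
  0M i j = 0#

  1M : ∀ {n} → Mat n
  1M i j with i Data.Fin.≟ j
  ... | Relation.Nullary.yes _ = 1#
  ... | Relation.Nullary.no  _ = 0#

  _*M_ : ∀ {n} → Mat n → Mat n → Mat n
  (A *M B) i j = sum (λ k → A i k * B k j)

  _^M_ : ∀ {n} → Mat n → ℕ → Mat n
  A ^M zero    = 1M
  A ^M (suc k) = A *M (A ^M k)

  Nilpotent : ∀ {n} → Mat n → Set ℓ
  Nilpotent A = ∃[ k ] ((A ^M k) ≈M 0M)

  lincomb : ∀ {n d} → (Fin d → Carrier) → (Fin d → Mat n) → Mat n
  lincomb c B i j = sum (λ t → c t * B t i j)

  LinearlyIndependent : ∀ {n d} → (Fin d → Mat n) → Set (c ⊔ ℓ)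
  LinearlyIndependent B = ∀ cs → lincomb cs B ≈M 0M → ∀ t → cs t ≈ 0#

  -- membership in S_G = ⟨ E_{i,j} | (i,j) ∈ E ⟩ : support contained in E
  InS : ∀ {n} → Digraph n → Mat n → Set ℓ
  InS G A = ∀ i j → G i j ≡ false → A i j ≈ 0#

  NilSubspaceDim : ∀ {n} → Digraph n → ℕ → Set (c ⊔ ℓ)
  NilSubspaceDim {n} G d =
    ∃[ B ] ((∀ t → InS G (B t)) ×
            LinearlyIndependent {n} {d} B ×
            (∀ cs → Nilpotent (lincomb cs B)))

{-# OPTIONS --safe #-}
module Submission where

-- Both maxima satisfy m(G) = max over vertices i of indeg(i) + m(G − i), loops at i not counted.
-- For acyclic subgraphs, take i a sink. For a nil subspace V there is an i such that V contains no
-- nonzero matrix supported on row i: otherwise suitable multiples of one such matrix per row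
-- add up to an element of V with a nonzero fixed vector. The matrices of V vanishing at all (a,i)
-- with a ≠ i form a subspace of codimension at most indeg(i); they also vanish at (i,i) by
-- nilpotency, so deleting row and column i maps them injectively onto a nil subspace for G − i.
-- Conversely, matrices supported on arcs along which f : [n] → ℕ decreases are nilpotent.

open import Defs
open import Level using (Level; _⊔_)
open import Data.Nat using (ℕ; zero; suc; _+_; _≤_; _<_; _<ᵇ_; _≤?_; z≤n; s≤s)
open import Data.Nat.Properties as ℕₚ using (+-0-commutativeMonoid)
open import Data.Fin as Fin using (Fin; zero; suc; toℕ; fromℕ; inject₁; punchIn; punchOut; splitAt; _≟_)
open import Data.Fin.Properties as Finₚ using (any?; all?; punchIn-injective; punchInᵢ≢i; punchIn-punchOut)
open import Data.Bool using (Bool; true; false; if_then_else_; _∧_)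
open import Data.Bool.Properties as Boolₚ using (¬-not; ∧-zeroʳ; ∧-identityʳ)
open import Data.Product using (Σ; ∃-syntax; _×_; _,_; proj₁; proj₂; uncurry)
open import Data.Product.Properties using (,-injectiveˡ)
open import Data.Sum using (_⊎_; inj₁; inj₂)
open import Data.Vec.Functional using (insertAt)
open import Data.Vec.Functional.Properties using (insertAt-lookup; insertAt-punchIn)
open import Function using (_∘_)
open import Function.Bundles using (Equivalence)
open import Function.Definitions using (Injective)
open import Relation.Nullary using (¬_; Dec; yes; no; contradiction)
open import Relation.Nullary.Decidable using (decidable-stable; ¬?; ¬¬-excluded-middle)
open import Relation.Binary.PropositionalEquality as ≡ using (_≡_; _≢_; refl; sym; trans; cong; cong₂; subst)
import Algebra.Properties.CommutativeMonoid.Sum +-0-commutativeMonoid as ℕΣ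
import Algebra.Properties.Semiring.Sum as SemiringSum
import Algebra.Properties.Ring as RingProperties
import Relation.Binary.Reasoning.Setoid as SetoidReasoning

private variable
  a p : Level
  A : Set a
  k n : ℕ

-- Equality in the field need not be decidable. Since index sets are finite, case distinctions on
-- all entries at once are still available under a double negation.
¬¬-all : ∀ n {P : Fin n → Set p} → (∀ i → ¬ ¬ P i) → ¬ ¬ (∀ i → P i)
¬¬-all zero    h r = r λ ()
¬¬-all (suc n) h r = h zero λ p₀ → ¬¬-all n (h ∘ suc) λ ps → r λ { zero → p₀ ; (suc i) → ps i }

∀-punchIn : ∀ (i : Fin (suc n)) (P : Fin (suc n) → Set p) →
            (∀ j → P (punchIn i j)) → P i → ∀ j → P j
∀-punchIn i P others at-i j with i ≟ j
... | yes refl = at-i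
... | no i≢j   = subst P (punchIn-punchOut i≢j) (others (punchOut i≢j))

-- If `i` were missed, `punchOut` at `i` would inject `suc n` elements into `n`.
injective⇒surjective : ∀ {n} (f : Fin n → Fin n) → Injective _≡_ _≡_ f → ∀ i → ∃[ j ] f j ≡ i
injective⇒surjective {suc n} f inj i with any? (λ j → f j ≟ i)
... | yes hit = hit
... | no miss = contradiction (Finₚ.injective⇒≤ {f = λ j → punchOut (miss ∘ (j ,_) ∘ sym)}
                                 (λ {j} {k} eq → inj (Finₚ.punchOut-injective (miss ∘ (j ,_) ∘ sym) (miss ∘ (k ,_) ∘ sym) eq)))
                              ℕₚ.1+n≰n

maximum : (h : Fin (suc n) → ℕ) → ∃[ i ] (∀ j → h j ≤ h i)
maximum {zero}  h = zero , λ { zero → ℕₚ.≤-refl }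
maximum {suc n} h with maximum (h ∘ suc)
... | i , i-max with ℕₚ.≤-total (h zero) (h (suc i))
...   | inj₁ 0≤i = suc i , λ { zero → 0≤i ; (suc j) → i-max j }
...   | inj₂ i≤0 = zero , λ { zero → ℕₚ.≤-refl ; (suc j) → ℕₚ.≤-trans (i-max j) i≤0 }

minor : Fin (suc n) → (Fin (suc n) → Fin (suc n) → A) → Fin n → Fin n → A
minor i M a b = M (punchIn i a) (punchIn i b)

-- Counting arcs

indicator : Bool → ℕ
indicator b = if b then 1 else 0

sumℕ≡sum : (f : Fin k → ℕ) → sumℕ f ≡ ℕΣ.sum f
sumℕ≡sum {zero}  f = refl
sumℕ≡sum {suc k} f = cong (f zero +_) (sumℕ≡sum (f ∘ suc))

countTrue≡sum : (f : Fin k → Bool) → countTrue f ≡ ℕΣ.sum (indicator ∘ f)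
countTrue≡sum {zero}  f = refl
countTrue≡sum {suc k} f = cong (indicator (f zero) +_) (countTrue≡sum (f ∘ suc))

countTrue-cong : {f g : Fin k → Bool} → (∀ i → f i ≡ g i) → countTrue f ≡ countTrue g
countTrue-cong {zero}  f≗g = refl
countTrue-cong {suc k} f≗g = cong₂ _+_ (cong indicator (f≗g zero)) (countTrue-cong (f≗g ∘ suc))

sumℕ-cong : {f g : Fin k → ℕ} → (∀ i → f i ≡ g i) → sumℕ f ≡ sumℕ g
sumℕ-cong {zero}  f≗g = refl
sumℕ-cong {suc k} f≗g = cong₂ _+_ (f≗g zero) (sumℕ-cong (f≗g ∘ suc))

countTrue-mono : (f g : Fin k → Bool) → (∀ i → f i ≡ true → g i ≡ true) → countTrue f ≤ countTrue g
countTrue-mono {zero}  f g f⇒g = z≤n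
countTrue-mono {suc k} f g f⇒g =
  ℕₚ.+-mono-≤ (indicator-mono (f zero) (g zero) (f⇒g zero)) (countTrue-mono (f ∘ suc) (g ∘ suc) (f⇒g ∘ suc))
  where
  indicator-mono : ∀ b c → (b ≡ true → c ≡ true) → indicator b ≤ indicator c
  indicator-mono false c     b⇒c = z≤n
  indicator-mono true  true  b⇒c = ℕₚ.≤-refl
  indicator-mono true  false b⇒c with () ← b⇒c refl

countTrue-false : (f : Fin k → Bool) → (∀ i → f i ≡ false) → countTrue f ≡ 0
countTrue-false {zero}  f f≡false = refl
countTrue-false {suc k} f f≡false rewrite f≡false zero = countTrue-false (f ∘ suc) (f≡false ∘ suc)

countTrue-remove : ∀ i (f : Fin (suc k) → Bool) →
                   countTrue f ≡ indicator (f i) + countTrue (f ∘ punchIn i)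
countTrue-remove i f = begin
  countTrue f                                               ≡⟨ countTrue≡sum f ⟩
  ℕΣ.sum (indicator ∘ f)                                    ≡⟨ ℕΣ.sum-remove {i = i} (indicator ∘ f) ⟩
  indicator (f i) + ℕΣ.sum (indicator ∘ f ∘ punchIn i)      ≡⟨ cong (indicator (f i) +_) (countTrue≡sum (f ∘ punchIn i)) ⟨
  indicator (f i) + countTrue (f ∘ punchIn i)               ∎
  where open ≡.≡-Reasoning

indegree : Fin (suc n) → Digraph (suc n) → ℕ
indegree i G = countTrue (λ j → G (punchIn i j) i)

-- Row `i` is taken out whole, with a possible loop; every other row then gives up its entry in
-- column `i`.
arcCount-remove : ∀ i (H : Digraph (suc n)) →
                  arcCount H ≡ countTrue (H i) + (indegree i H + arcCount (minor i H))
arcCount-remove i H = begin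
  arcCount H
    ≡⟨ sumℕ≡sum (countTrue ∘ H) ⟩
  ℕΣ.sum (countTrue ∘ H)
    ≡⟨ ℕΣ.sum-remove {i = i} (countTrue ∘ H) ⟩
  countTrue (H i) + ℕΣ.sum (λ j → countTrue (H (punchIn i j)))
    ≡⟨ cong (countTrue (H i) +_) (ℕΣ.sum-cong-≗ (λ j → countTrue-remove i (H (punchIn i j)))) ⟩
  countTrue (H i) + ℕΣ.sum (λ j → indicator (H (punchIn i j) i) + countTrue (minor i H j))
    ≡⟨ cong (countTrue (H i) +_) (ℕΣ.∑-distrib-+ (λ j → indicator (H (punchIn i j) i)) (countTrue ∘ minor i H)) ⟩
  countTrue (H i) + (ℕΣ.sum (λ j → indicator (H (punchIn i j) i)) + ℕΣ.sum (countTrue ∘ minor i H))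
    ≡⟨ cong (countTrue (H i) +_) (cong₂ _+_ (countTrue≡sum (λ j → H (punchIn i j) i)) (sumℕ≡sum (countTrue ∘ minor i H))) ⟨
  countTrue (H i) + (indegree i H + arcCount (minor i H))
    ∎
  where open ≡.≡-Reasoning

enumerateTrue : (f : Fin k → Bool) →
                ∃[ e ] (Injective _≡_ _≡_ e × (∀ (t : Fin (countTrue f)) → f (e t) ≡ true))
enumerateTrue {zero}  f = (λ ()) , (λ { {()} }) , λ ()
enumerateTrue {suc k} f with f zero in f₀ | enumerateTrue (f ∘ suc)
... | false | e , inj , e-true = suc ∘ e , inj ∘ Finₚ.suc-injective , e-true
... | true  | e , inj , e-true = e′ , inj′ , λ { zero → f₀ ; (suc t) → e-true t }
  where
  e′ : Fin (suc (countTrue (f ∘ suc))) → Fin (suc k)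
  e′ zero    = zero
  e′ (suc t) = suc (e t)
  inj′ : Injective _≡_ _≡_ e′
  inj′ {zero}  {zero}  eq = refl
  inj′ {suc s} {suc t} eq = cong suc (inj (Finₚ.suc-injective eq))

enumerateΣ : (g : Fin k → ℕ) → Σ (Fin (sumℕ g) → Σ (Fin k) (Fin ∘ g)) (Injective _≡_ _≡_)
enumerateΣ {zero}  g = (λ ()) , λ { {()} }
enumerateΣ {suc k} g = place ∘ splitAt (g zero) , λ eq → splitAt-injective (place-injective eq)
  where
  rest = enumerateΣ (g ∘ suc)
  place : Fin (g zero) ⊎ Fin (sumℕ (g ∘ suc)) → Σ (Fin (suc k)) (Fin ∘ g)
  place (inj₁ s) = zero , s
  place (inj₂ t) = suc (proj₁ (proj₁ rest t)) , proj₂ (proj₁ rest t)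
  unshift : ∀ {i j} {s : Fin (g (suc i))} {t : Fin (g (suc j))} →
            _≡_ {A = Σ (Fin (suc k)) (Fin ∘ g)} (suc i , s) (suc j , t) →
            _≡_ {A = Σ (Fin k) (Fin ∘ g ∘ suc)} (i , s) (j , t)
  unshift refl = refl
  place-injective : Injective _≡_ _≡_ place
  place-injective {inj₁ s} {inj₁ t} refl = refl
  place-injective {inj₂ s} {inj₂ t} eq   = cong inj₂ (proj₂ rest (unshift eq))
  splitAt-injective : Injective _≡_ _≡_ (splitAt (g zero))
  splitAt-injective {s} {t} eq =
    trans (sym (Finₚ.join-splitAt (g zero) _ s))
          (trans (cong (Fin.join (g zero) _) eq) (Finₚ.join-splitAt (g zero) _ t))

-- Injectivity of this indexing is what later makes the elementary matrices of the arcs linearly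
-- independent.
arcs : (H : Digraph n) →
       Σ (Fin (arcCount H) → Fin n × Fin n) λ e → Injective _≡_ _≡_ e × (∀ t → uncurry H (e t) ≡ true)
arcs H = arc ∘ proj₁ rows , (λ eq → proj₂ rows (arc-injective eq)) , λ t → arc-true (proj₁ rows t)
  where
  rows = enumerateΣ (countTrue ∘ H)
  arc : Σ (Fin _) (Fin ∘ countTrue ∘ H) → Fin _ × Fin _
  arc (i , t) = i , proj₁ (enumerateTrue (H i)) t
  arc-injective : Injective _≡_ _≡_ arc
  arc-injective {i , s} {j , t} eq with ,-injectiveˡ eq
  ... | refl = cong (i ,_) (proj₁ (proj₂ (enumerateTrue (H i))) (cong proj₂ eq))
  arc-true : ∀ x → uncurry H (arc x) ≡ true
  arc-true (i , t) = proj₂ (proj₂ (enumerateTrue (H i))) t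

-- Acyclic subgraphs

-- The recursion shared by both maxima, taken as a definition. Each maximum is compared with this
-- number, never directly with the other.
maxAcyclic : ∀ n → Digraph n → ℕ
maxAcyclic zero    G = 0
maxAcyclic (suc n) G = h (proj₁ (maximum h))
  where
  h : Fin (suc n) → ℕ
  h i = indegree i G + maxAcyclic n (minor i G)

indegree+maxAcyclic-minor≤ : ∀ (G : Digraph (suc n)) i →
                             indegree i G + maxAcyclic n (minor i G) ≤ maxAcyclic (suc n) G
indegree+maxAcyclic-minor≤ G = proj₂ (maximum (λ i → indegree i G + maxAcyclic _ (minor i G)))

-- A height function certifies acyclicity and also bounds the lengths of walks, which gives
-- nilpotency.
descending : (Fin n → ℕ) → Digraph n → Digraph n
descending f G i j = G i j ∧ (f j <ᵇ f i)

descending-⊆ : ∀ (f : Fin n → ℕ) G → descending f G ⊆G G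
descending-⊆ f G i j arc with true ← G i j = refl

descending-< : ∀ (f : Fin n → ℕ) G i j → descending f G i j ≡ true → f j < f i
descending-< f G i j arc with true ← G i j = ℕₚ.<ᵇ⇒< (f j) (f i) (Equivalence.from Boolₚ.T-≡ arc)

-- The heights along the path never rise, so the closing arc, which must descend to the first
-- vertex, cannot exist.
descending-acyclic : ∀ (f : Fin n → ℕ) G → Acyclic (descending f G)
descending-acyclic f G k v (_ , steps , last) =
  ℕₚ.<⇒≱ (descending-< f G _ _ last) (last≤first k (f ∘ v) (λ i → descending-< f G _ _ (steps i)))
  where
  last≤first : ∀ k (g : Fin (suc k) → ℕ) → (∀ i → g (suc i) < g (inject₁ i)) → g (fromℕ k) ≤ g zero
  last≤first zero    g g-desc = ℕₚ.≤-refl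
  last≤first (suc k) g g-desc =
    ℕₚ.≤-trans (last≤first k (g ∘ suc) (g-desc ∘ suc)) (ℕₚ.<⇒≤ (g-desc zero))

maxAcyclic-attained : ∀ n (G : Digraph n) → ∃[ f ] arcCount (descending f G) ≡ maxAcyclic n G
maxAcyclic-attained zero    G = (λ ()) , refl
maxAcyclic-attained (suc n) G = f , (begin
  arcCount H                                                  ≡⟨ arcCount-remove i H ⟩
  countTrue (H i) + (indegree i H + arcCount (minor i H))     ≡⟨ cong₂ _+_ (countTrue-false (H i) no-out)
                                                                  (cong₂ _+_ (countTrue-cong all-in)
                                                                    (sumℕ-cong (λ a → countTrue-cong (minor-H a)))) ⟩
  indegree i G + arcCount (descending f′ (minor i G))         ≡⟨ cong (indegree i G +_) (proj₂ rec) ⟩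
  indegree i G + maxAcyclic n (minor i G)                     ∎)
  where
  open ≡.≡-Reasoning
  i   = proj₁ (maximum (λ i → indegree i G + maxAcyclic n (minor i G)))
  rec = maxAcyclic-attained n (minor i G)
  f′  = proj₁ rec
  f : Fin (suc n) → ℕ
  -- Height 0 at `i`, below all others, makes `i` a sink and keeps every arc into `i` from another
  -- vertex; raising the other heights by one preserves their order.
  f = insertAt (suc ∘ f′) i 0
  H = descending f G
  no-out : ∀ j → H i j ≡ false
  no-out j rewrite insertAt-lookup (suc ∘ f′) i 0 = ∧-zeroʳ (G i j)
  all-in : ∀ a → H (punchIn i a) i ≡ G (punchIn i a) i
  all-in a rewrite insertAt-lookup (suc ∘ f′) i 0 | insertAt-punchIn (suc ∘ f′) i 0 a =
    ∧-identityʳ (G (punchIn i a) i)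
  minor-H : ∀ a b → minor i H a b ≡ descending f′ (minor i G) a b
  minor-H a b rewrite insertAt-punchIn (suc ∘ f′) i 0 a | insertAt-punchIn (suc ∘ f′) i 0 b = refl

module _ {n} (H : Digraph n) (acyclic : Acyclic H)
         (next : Fin n → Fin n) (next-arc : ∀ i → H i (next i) ≡ true) (start : Fin n) where

  walk : ℕ → Fin n
  walk zero    = start
  walk (suc k) = next (walk k)

  -- Mutual induction with `walk-no-return`. If step `b` returned to step `x`, the vertices from `x`
  -- to `b - 1`, distinct by induction, would form a directed cycle.
  walk-distinct : ∀ b {x y} → x < b → y < b → walk x ≡ walk y → x ≡ y
  walk-no-return : ∀ {b} x → x < b → walk x ≢ walk b

  walk-distinct (suc b) {x} {y} x<1+b y<1+b eq
    with ℕₚ.m<1+n⇒m<n∨m≡n x<1+b | ℕₚ.m<1+n⇒m<n∨m≡n y<1+b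
  ... | inj₁ x<b  | inj₁ y<b  = walk-distinct b x<b y<b eq
  ... | inj₁ x<b  | inj₂ refl = contradiction eq (walk-no-return x x<b)
  ... | inj₂ refl | inj₁ y<b  = contradiction (sym eq) (walk-no-return y y<b)
  ... | inj₂ refl | inj₂ refl = refl

  walk-no-return x x<b eq with ℕₚ.m≤n⇒∃[o]m+o≡n x<b
  ... | k , refl = acyclic k v
        ( (λ {i} {j} vi≡vj → Finₚ.toℕ-injective (ℕₚ.+-cancelˡ-≡ x _ _ (walk-distinct (suc (x + k)) (bound i) (bound j) vi≡vj)))
        , (λ i → subst (λ w → H (v (inject₁ i)) w ≡ true) (step i) (next-arc _))
        , subst (λ w → H (v (fromℕ k)) w ≡ true) closing (next-arc _) )
    where
    v : Fin (suc k) → Fin n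
    v i = walk (x + toℕ i)
    bound : ∀ (i : Fin (suc k)) → x + toℕ i < suc (x + k)
    bound i = s≤s (ℕₚ.+-monoʳ-≤ x (Finₚ.toℕ≤pred[n] i))
    step : ∀ i → walk (suc (x + toℕ (inject₁ i))) ≡ v (suc i)
    step i = cong walk (trans (cong (λ m → suc (x + m)) (Finₚ.toℕ-inject₁ i)) (sym (ℕₚ.+-suc x (toℕ i))))
    closing : walk (suc (x + toℕ (fromℕ k))) ≡ v zero
    closing = trans (cong (λ m → walk (suc (x + m))) (Finₚ.toℕ-fromℕ k))
                    (trans (sym eq) (cong walk (sym (ℕₚ.+-identityʳ x))))

  -- By pigeonhole: the first `suc n` vertices of the walk would be distinct among `n` vertices.
  acyclic-not-serial : ∀ {ℓ} {A : Set ℓ} → A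
  acyclic-not-serial = contradiction
    (Finₚ.injective⇒≤ {f = λ (i : Fin (suc n)) → walk (toℕ i)}
      (λ {i} {j} eq → Finₚ.toℕ-injective (walk-distinct (suc n) (Finₚ.toℕ<n i) (Finₚ.toℕ<n j) eq)))
    ℕₚ.1+n≰n

acyclic⇒sink : (H : Digraph (suc n)) → Acyclic H → ∃[ i ] (∀ j → H i j ≡ false)
acyclic⇒sink H acyclic with any? (λ i → all? (λ j → H i j Boolₚ.≟ false))
... | yes sink = sink
... | no ¬sink = acyclic-not-serial H acyclic (proj₁ ∘ out) (proj₂ ∘ out) zero
  where
  out : ∀ i → ∃[ j ] H i j ≡ true
  out i with any? (λ j → H i j Boolₚ.≟ true)
  ... | yes arc = arc
  ... | no ¬arc = contradiction (i , λ j → ¬-not (λ arc → ¬arc (j , arc))) ¬sink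

minor-acyclic : ∀ i (H : Digraph (suc n)) → Acyclic H → Acyclic (minor i H)
minor-acyclic i H acyclic k v (inj , steps , last) =
  acyclic k (punchIn i ∘ v) ((λ eq → inj (punchIn-injective i _ _ eq)) , steps , last)

arcCount≤maxAcyclic : ∀ n (G H : Digraph n) → H ⊆G G → Acyclic H → arcCount H ≤ maxAcyclic n G
arcCount≤maxAcyclic zero    G H H⊆G acyclic = z≤n
arcCount≤maxAcyclic (suc n) G H H⊆G acyclic with acyclic⇒sink H acyclic
... | i , sink = begin
  arcCount H                                                ≡⟨ arcCount-remove i H ⟩
  countTrue (H i) + (indegree i H + arcCount (minor i H))   ≡⟨ cong (_+ (indegree i H + arcCount (minor i H))) (countTrue-false (H i) sink) ⟩
  indegree i H + arcCount (minor i H)                       ≤⟨ ℕₚ.+-mono-≤ (countTrue-mono _ _ (λ j → H⊆G (punchIn i j) i))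
                                                                (arcCount≤maxAcyclic n (minor i G) (minor i H)
                                                                  (λ a b → H⊆G _ _) (minor-acyclic i H acyclic)) ⟩
  indegree i G + maxAcyclic n (minor i G)                   ≤⟨ indegree+maxAcyclic-minor≤ G i ⟩
  maxAcyclic (suc n) G                                      ∎
  where open ℕₚ.≤-Reasoning

maxAcyclic-maximum : ∀ n (G : Digraph n) → IsMaximum (AcyclicSpanningSize G) (maxAcyclic n G)
maxAcyclic-maximum n G with maxAcyclic-attained n G
... | f , size = (descending f G , descending-⊆ f G , descending-acyclic f G , size) ,
                 λ { _ (H , H⊆G , acyclic , refl) → arcCount≤maxAcyclic n G H H⊆G acyclic }

-- Nil subspaces

module NilSubspaces {c ℓ} (𝔽 : Field c ℓ) where
  private module F = Field 𝔽
  open Field 𝔽 using (Carrier; _≈_; _*_; -_; 0#; 1#) renaming (_+_ to _⊕_)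
  open Matrices 𝔽
  open SemiringSum F.semiring
    using (sum; sum-cong-≋; sum-remove; sum-replicate-zero; ∑-distrib-+; ∑-comm; *-distribˡ-sum; *-distribʳ-sum)
  open RingProperties F.ring using (-‿distribˡ-*)
  open SetoidReasoning F.setoid

  -- Finite sums and the identity matrix.

  sum-zero : (f : Fin n → Carrier) → (∀ i → f i ≈ 0#) → sum f ≈ 0#
  sum-zero {n} f f≈0 = F.trans (sum-cong-≋ f≈0) (sum-replicate-zero n)

  sum-single : ∀ i (f : Fin n → Carrier) → (∀ j → j ≢ i → f j ≈ 0#) → sum f ≈ f i
  sum-single {n = suc n} i f f≈0 = begin
    sum f                      ≈⟨ sum-remove {i = i} f ⟩
    f i ⊕ sum (f ∘ punchIn i)  ≈⟨ F.+-congˡ (sum-zero _ (λ j → f≈0 _ (punchInᵢ≢i i j))) ⟩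
    f i ⊕ 0#                   ≈⟨ F.+-identityʳ _ ⟩
    f i                        ∎

  x*y≈0ˡ : ∀ {x} y → x ≈ 0# → x * y ≈ 0#
  x*y≈0ˡ y x≈0 = F.trans (F.*-congʳ x≈0) (F.zeroˡ y)

  x*y≈0ʳ : ∀ x {y} → y ≈ 0# → x * y ≈ 0#
  x*y≈0ʳ x y≈0 = F.trans (F.*-congˡ y≈0) (F.zeroʳ x)

  1M-diagonal : ∀ (i : Fin n) → 1M i i ≈ 1#
  1M-diagonal i with i ≟ i
  ... | yes _  = F.refl
  ... | no i≢i = contradiction refl i≢i

  1M-off : ∀ {i j : Fin n} → i ≢ j → 1M i j ≈ 0#
  1M-off {i = i} {j} i≢j with i ≟ j
  ... | yes i≡j = contradiction i≡j i≢j
  ... | no _    = F.refl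

  1M-minor : ∀ i (a b : Fin n) → 1M a b ≈ 1M (punchIn i a) (punchIn i b)
  1M-minor i a b with a ≟ b
  ... | yes refl = F.sym (1M-diagonal (punchIn i a))
  ... | no a≢b   = F.sym (1M-off (a≢b ∘ punchIn-injective i a b))

  -- Fixed vectors, powers and minors.

  infixr 7 _·_
  _·_ : Mat n → (Fin n → Carrier) → Fin n → Carrier
  (M · x) i = sum (λ j → M i j * x j)

  fixed-by-powers : ∀ (M : Mat n) x → (∀ i → (M · x) i ≈ x i) → ∀ k i → ((M ^M k) · x) i ≈ x i
  fixed-by-powers M x fixed zero i = begin
    sum (λ j → 1M i j * x j)  ≈⟨ sum-single i _ (λ j j≢i → x*y≈0ˡ (x j) (1M-off (j≢i ∘ sym))) ⟩
    1M i i * x i              ≈⟨ F.*-congʳ (1M-diagonal i) ⟩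
    1# * x i                  ≈⟨ F.*-identityˡ (x i) ⟩
    x i                       ∎
  fixed-by-powers M x fixed (suc k) i = begin
    sum (λ j → sum (λ l → M i l * P l j) * x j)    ≈⟨ sum-cong-≋ (λ j → *-distribʳ-sum (x j) (λ l → M i l * P l j)) ⟩
    sum (λ j → sum (λ l → M i l * P l j * x j))    ≈⟨ ∑-comm (λ j l → M i l * P l j * x j) ⟩
    sum (λ l → sum (λ j → M i l * P l j * x j))    ≈⟨ sum-cong-≋ (λ l → sum-cong-≋ (λ j → F.*-assoc (M i l) (P l j) (x j))) ⟩
    sum (λ l → sum (λ j → M i l * (P l j * x j)))  ≈⟨ sum-cong-≋ (λ l → *-distribˡ-sum (M i l) (λ j → P l j * x j)) ⟨
    sum (λ l → M i l * (P · x) l)                  ≈⟨ sum-cong-≋ (λ l → F.*-congˡ (fixed-by-powers M x fixed k l)) ⟩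
    (M · x) i                                      ≈⟨ fixed i ⟩
    x i                                            ∎
    where P = M ^M k

  -- A fixed vector is fixed by every power, including one that is zero. The arguments on free rows
  -- and on diagonal entries both end in this contradiction.
  nilpotent-fixed : ∀ {M : Mat n} x → Nilpotent M → (∀ i → (M · x) i ≈ x i) → ∀ i → x i ≈ 0#
  nilpotent-fixed {M = M} x (k , Mᵏ≈0) fixed i = begin
    x i                ≈⟨ fixed-by-powers M x fixed k i ⟨
    ((M ^M k) · x) i   ≈⟨ sum-zero _ (λ j → x*y≈0ˡ (x j) (Mᵏ≈0 i j)) ⟩
    0#                 ∎

  -- As column `i` of `M` is zero, no term of a product `M * M^k` passes through the index `i`.
  power-minor : ∀ i (M : Mat (suc n)) (N : Mat n) → (∀ a → M a i ≈ 0#) → N ≈M minor i M →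
                ∀ k → (N ^M k) ≈M minor i (M ^M k)
  power-minor i M N column N≈ zero    a b = 1M-minor i a b
  power-minor i M N column N≈ (suc k) a b = begin
    sum (λ e → N a e * (N ^M k) e b)
      ≈⟨ sum-cong-≋ (λ e → F.*-cong (N≈ a e) (power-minor i M N column N≈ k e b)) ⟩
    sum (g ∘ punchIn i)
      ≈⟨ F.+-identityˡ _ ⟨
    0# ⊕ sum (g ∘ punchIn i)
      ≈⟨ F.+-congʳ (x*y≈0ˡ _ (column (punchIn i a))) ⟨
    g i ⊕ sum (g ∘ punchIn i)
      ≈⟨ sum-remove {i = i} g ⟨
    sum g
      ∎
    where
    g = λ e → M (punchIn i a) e * (M ^M k) e (punchIn i b)

  nilpotent-minor : ∀ i (M : Mat (suc n)) (N : Mat n) → (∀ a → M a i ≈ 0#) → N ≈M minor i M →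
                    Nilpotent M → Nilpotent N
  nilpotent-minor i M N column N≈ (k , Mᵏ≈0) =
    k , λ a b → F.trans (power-minor i M N column N≈ k a b) (Mᵏ≈0 _ _)

  -- Equality in 𝔽 need not be decidable or stable, so this form of independence is
  -- what survives arguing under double negation.
  Independent : ∀ {d} → (Fin d → Mat n) → Set (c ⊔ ℓ)
  Independent B = ∀ cs → lincomb cs B ≈M 0M → ∀ t → ¬ ¬ cs t ≈ 0#

  -- Subspaces and elimination of entries.

  MatPred : ℕ → Set (Level.suc (c ⊔ ℓ))
  MatPred n = Mat n → Set (c ⊔ ℓ)

  -- Closure is stated for `x M + N`, the shape to which the sum in `lincomb` unfolds, so `lincomb∈`
  -- needs no transport along `≈M`.
  record IsSubspace (V : MatPred n) : Set (c ⊔ ℓ) where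
    field
      zero∈ : V 0M
      axpy∈ : ∀ x {M N} → V M → V N → V (λ i j → x * M i j ⊕ N i j)

    lincomb∈ : ∀ {d} cs (B : Fin d → Mat n) → (∀ t → V (B t)) → V (lincomb cs B)
    lincomb∈ {zero}  cs B B∈ = zero∈
    lincomb∈ {suc d} cs B B∈ = axpy∈ (cs zero) (B∈ zero) (lincomb∈ (cs ∘ suc) (B ∘ suc) (B∈ ∘ suc))

  open IsSubspace

  IndependentIn : MatPred n → ℕ → Set (c ⊔ ℓ)
  IndependentIn V d = Σ (Fin d → Mat _) λ B → (∀ t → V (B t)) × Independent B

  _∩[_,_]≈0 : MatPred n → Fin n → Fin n → MatPred n
  (V ∩[ i , j ]≈0) M = V M × M i j ≈ 0#

  axpy-zero : ∀ x {y z} → y ≈ 0# → z ≈ 0# → x * y ⊕ z ≈ 0#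
  axpy-zero x y≈0 z≈0 = F.trans (F.+-cong (x*y≈0ʳ x y≈0) z≈0) (F.+-identityˡ 0#)

  ∩-isSubspace : ∀ {V : MatPred n} i j → IsSubspace V → IsSubspace (V ∩[ i , j ]≈0)
  ∩-isSubspace i j sub = record
    { zero∈ = zero∈ sub , F.refl
    ; axpy∈ = λ { x (M∈ , M≈0) (N∈ , N≈0) → axpy∈ sub x M∈ N∈ , axpy-zero x M≈0 N≈0 }
    }

  -- One step of Gaussian elimination: multiples of the pivot matrix `B s` clear entry `(i , j)` of
  -- the others, and `B s` is dropped.
  pivot-elimination : ∀ {V : MatPred n} → IsSubspace V → ∀ i j {d} →
                      (F : IndependentIn V (suc d)) → ∃[ s ] ¬ (proj₁ F s i j ≈ 0#) →
                      IndependentIn (V ∩[ i , j ]≈0) d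
  pivot-elimination {V = V} sub i j {d} (B , B∈ , independent) (s , Bₛ≉0) =
    B′ , (λ u → axpy∈ sub (q u) (B∈ s) (B∈ (punchIn s u)) , cancels u) , independent′
    where
    y = proj₁ (F.inverse (B s i j) Bₛ≉0)
    q : Fin d → Carrier
    q u = - (B (punchIn s u) i j * y)
    B′ : Fin d → Mat _
    B′ u a b = q u * B s a b ⊕ B (punchIn s u) a b
    cancels : ∀ u → B′ u i j ≈ 0#
    cancels u = begin
      - (z * y) * B s i j ⊕ z    ≈⟨ F.+-congʳ (-‿distribˡ-* (z * y) (B s i j)) ⟨
      - (z * y * B s i j) ⊕ z    ≈⟨ F.+-congʳ (F.-‿cong (begin
        z * y * B s i j             ≈⟨ F.*-assoc z y (B s i j) ⟩
        z * (y * B s i j)           ≈⟨ F.*-congˡ (F.trans (F.*-comm y (B s i j)) (proj₂ (F.inverse (B s i j) Bₛ≉0))) ⟩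
        z * 1#                      ≈⟨ F.*-identityʳ z ⟩
        z                           ∎)) ⟩
      - z ⊕ z                    ≈⟨ F.-‿inverseˡ z ⟩
      0#                         ∎
      where z = B (punchIn s u) i j
    independent′ : Independent B′
    independent′ cs cs·B′≈0 u cᵤ≉0 =
      independent cs⁺ (λ a b → F.trans (cs⁺·B≈cs·B′ a b) (cs·B′≈0 a b)) (punchIn s u)
        (cᵤ≉0 ∘ subst (_≈ 0#) (insertAt-punchIn cs s σ u))
      where
      -- The total coefficient that `B s` receives when a combination of `B′` is rewritten in terms
      -- of `B`.
      σ   = sum (λ u → cs u * q u)
      cs⁺ = insertAt cs s σ
      cs⁺·B≈cs·B′ : ∀ a b → lincomb cs⁺ B a b ≈ lincomb cs B′ a b
      cs⁺·B≈cs·B′ a b = begin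
        sum (λ t → cs⁺ t * B t a b)
          ≈⟨ sum-remove {i = s} (λ t → cs⁺ t * B t a b) ⟩
        cs⁺ s * B s a b ⊕ sum (λ u → cs⁺ (punchIn s u) * B (punchIn s u) a b)
          ≈⟨ F.+-cong (F.*-congʳ (F.reflexive (insertAt-lookup cs s σ)))
               (sum-cong-≋ (λ u → F.*-congʳ (F.reflexive (insertAt-punchIn cs s σ u)))) ⟩
        σ * B s a b ⊕ sum (λ u → cs u * B (punchIn s u) a b)
          ≈⟨ F.+-congʳ (*-distribʳ-sum (B s a b) (λ u → cs u * q u)) ⟩
        sum (λ u → cs u * q u * B s a b) ⊕ sum (λ u → cs u * B (punchIn s u) a b)
          ≈⟨ ∑-distrib-+ (λ u → cs u * q u * B s a b) (λ u → cs u * B (punchIn s u) a b) ⟨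
        sum (λ u → cs u * q u * B s a b ⊕ cs u * B (punchIn s u) a b)
          ≈⟨ sum-cong-≋ (λ u → F.+-congʳ (F.*-assoc (cs u) (q u) (B s a b))) ⟩
        sum (λ u → cs u * (q u * B s a b) ⊕ cs u * B (punchIn s u) a b)
          ≈⟨ sum-cong-≋ (λ u → F.distribˡ (cs u) (q u * B s a b) (B (punchIn s u) a b)) ⟨
        sum (λ u → cs u * B′ u a b)
          ∎

  -- Either some family member is a pivot and one dimension is lost, or all of them vanish at the
  -- entry and none is. The choice between the cases needs the double negation.
  eliminate-entry : ∀ {V : MatPred n} → IsSubspace V → ∀ i j {d} → IndependentIn V d →
                    ¬ ¬ (∃[ d′ ] (d ≤ suc d′ × IndependentIn (V ∩[ i , j ]≈0) d′))
  eliminate-entry sub i j {zero} (B , B∈ , independent) r = r (0 , z≤n , B , (λ ()) , independent)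
  eliminate-entry sub i j {suc d} F@(B , B∈ , independent) r =
    ¬¬-excluded-middle {A = ∃[ s ] ¬ (B s i j ≈ 0#)} λ
      { (yes pivot) → r (d , ℕₚ.≤-refl , pivot-elimination sub i j F pivot)
      ; (no ¬pivot) → ¬¬-all _ (λ t Bₜ≉0 → ¬pivot (t , Bₜ≉0)) λ B≈0 →
          r (suc d , ℕₚ.n≤1+n _ , B , (λ t → B∈ t , B≈0 t) , independent)
      }

  -- `g` marks the positions where `V` may be nonzero. Unmarked positions already vanish and cost
  -- nothing, so the loss is bounded by `countTrue g` rather than by `k`.
  eliminate-entries : ∀ {V : MatPred n} → IsSubspace V → ∀ {k} (e : Fin k → Fin n × Fin n) (g : Fin k → Bool) →
                      (∀ s → g s ≡ false → ∀ {M} → V M → uncurry M (e s) ≈ 0#) →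
                      ∀ {d} → IndependentIn V d →
                      ¬ ¬ (∃[ d′ ] (d ≤ countTrue g + d′ ×
                                    IndependentIn (λ M → V M × ∀ s → uncurry M (e s) ≈ 0#) d′))
  eliminate-entries sub {zero} e g g-false (B , B∈ , independent) r =
    r (_ , ℕₚ.≤-refl , B , (λ t → B∈ t , λ ()) , independent)
  eliminate-entries {V = V} sub {suc k} e g g-false {d} F r =
    eliminate-first (g zero) (g-false zero) λ { (d₁ , d≤ , F₁) →
    eliminate-entries (∩-isSubspace i j sub) (e ∘ suc) (g ∘ suc) (λ s gₛ → g-false (suc s) gₛ ∘ proj₁) F₁ λ
      { (d′ , d₁≤ , B , B∈ , independent) →
        r ( d′
          , ℕₚ.≤-trans d≤ (ℕₚ.≤-trans (ℕₚ.+-monoʳ-≤ (indicator (g zero)) d₁≤)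
              (ℕₚ.≤-reflexive (sym (ℕₚ.+-assoc (indicator (g zero)) _ d′))))
          , B
          , (λ t → proj₁ (proj₁ (B∈ t)) , λ { zero → proj₂ (proj₁ (B∈ t)) ; (suc s) → proj₂ (B∈ t) s })
          , independent ) } }
    where
    i = proj₁ (e zero)
    j = proj₂ (e zero)
    eliminate-first : ∀ b → (b ≡ false → ∀ {M} → V M → M i j ≈ 0#) →
                      ¬ ¬ (∃[ d₁ ] (d ≤ indicator b + d₁ × IndependentIn (V ∩[ i , j ]≈0) d₁))
    eliminate-first true  _    r′ = eliminate-entry sub i j F r′
    eliminate-first false V≈0 r′ =
      let B , B∈ , independent = F in r′ (d , ℕₚ.≤-refl , B , (λ t → B∈ t , V≈0 refl (B∈ t)) , independent)

  -- If no index j can be deleted with all remaining rows staying nonzero, then every j is the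
  -- support of some row; so each row is supported on one entry and the all-ones vector works.
  nonvanishing-vector : ∀ n (R : Mat (suc n)) → (∀ i j → Dec (R i j ≈ 0#)) → (∀ i → ∃[ j ] ¬ (R i j ≈ 0#)) →
                        ∃[ x ] ((∃[ i ] ¬ (x i ≈ 0#)) × (∀ i → x i ≈ 0# ⊎ ¬ ((R · x) i ≈ 0#)))
  nonvanishing-vector zero R dec nonzero = (λ _ → 1#) , (zero , F.1≉0) , λ { zero → inj₂ (R·1≉0 (nonzero zero)) }
    where
    R·1≉0 : ∃[ j ] ¬ (R zero j ≈ 0#) → ¬ (R zero zero * 1# ⊕ 0# ≈ 0#)
    R·1≉0 (zero , R≉0) eq = R≉0 (F.trans (F.sym (F.trans (F.+-identityʳ _) (F.*-identityʳ _))) eq)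
  nonvanishing-vector (suc n) R dec nonzero
    with any? (λ j → all? (λ a → any? (λ b → ¬? (dec (punchIn j a) (punchIn j b)))))
  ... | yes (j , nonzero′) with nonvanishing-vector n (minor j R) (λ a b → dec _ _) nonzero′
  ...   | x , (a , xₐ≉0) , covers = x⁺ , (punchIn j a , xₐ≉0 ∘ subst (_≈ 0#) (insertAt-punchIn x j 0# a))
                                  , ∀-punchIn j _ covers⁺ (inj₁ (F.reflexive (insertAt-lookup x j 0#)))
    where
    -- A zero coordinate at `j` covers row `j` by the first alternative and leaves the products with
    -- the other rows as they are in the minor.
    x⁺ = insertAt x j 0#
    R·x⁺ : ∀ i → (R · x⁺) i ≈ sum (λ b → R i (punchIn j b) * x b)
    R·x⁺ i = begin
      sum (λ b → R i b * x⁺ b)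
        ≈⟨ sum-remove {i = j} (λ b → R i b * x⁺ b) ⟩
      R i j * x⁺ j ⊕ sum (λ b → R i (punchIn j b) * x⁺ (punchIn j b))
        ≈⟨ F.+-cong (x*y≈0ʳ (R i j) (F.reflexive (insertAt-lookup x j 0#)))
             (sum-cong-≋ (λ b → F.*-congˡ {R i (punchIn j b)} (F.reflexive (insertAt-punchIn x j 0# b)))) ⟩
      0# ⊕ sum (λ b → R i (punchIn j b) * x b)
        ≈⟨ F.+-identityˡ _ ⟩
      sum (λ b → R i (punchIn j b) * x b)
        ∎
    covers⁺ : ∀ a → x⁺ (punchIn j a) ≈ 0# ⊎ ¬ ((R · x⁺) (punchIn j a) ≈ 0#)
    covers⁺ a with covers a
    ... | inj₁ xₐ≈0 = inj₁ (F.trans (F.reflexive (insertAt-punchIn x j 0# a)) xₐ≈0)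
    ... | inj₂ Rx≉0 = inj₂ (λ eq → Rx≉0 (F.trans (F.sym (R·x⁺ (punchIn j a))) eq))
  nonvanishing-vector (suc n) R dec nonzero | no ¬deletable =
    (λ _ → 1#) , (zero , F.1≉0) , λ i → inj₂ (R·1≉0 i)
    where
    -- Deletion of `j` fails only because some remaining row becomes zero, that is, has all its
    -- entries in column `j`.
    supported : ∀ j → ∃[ i ] (∀ b → b ≢ j → R i b ≈ 0#)
    supported j with any? (λ a → all? (λ b → dec (punchIn j a) (punchIn j b)))
    ... | yes (a , R≈0) = punchIn j a ,
            λ b b≢j → subst (λ b → R (punchIn j a) b ≈ 0#) (punchIn-punchOut (b≢j ∘ sym)) (R≈0 (punchOut (b≢j ∘ sym)))
    ... | no ¬supported = contradiction (j , nonzero′) ¬deletable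
      where
      nonzero′ : ∀ a → ∃[ b ] ¬ (minor j R a b ≈ 0#)
      nonzero′ a with any? (λ b → ¬? (dec (punchIn j a) (punchIn j b)))
      ... | yes hit = hit
      ... | no miss = contradiction (a , λ b → decidable-stable (dec _ _) (λ R≉0 → miss (b , R≉0))) ¬supported
    r = proj₁ ∘ supported
    pivot≉0 : ∀ j → ¬ (R (r j) j ≈ 0#)
    pivot≉0 j R≈0 with nonzero (r j)
    ... | b , Rb≉0 with b ≟ j
    ...   | yes refl = Rb≉0 R≈0
    ...   | no b≢j   = Rb≉0 (proj₂ (supported j) b b≢j)
    r-injective : Injective _≡_ _≡_ r
    r-injective {j} {k} rj≡rk with j ≟ k
    ... | yes j≡k = j≡k
    ... | no j≢k  = contradiction (subst (λ i → R i j ≈ 0#) (sym rj≡rk) (proj₂ (supported k) j j≢k)) (pivot≉0 j)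
    R·1≉0 : ∀ i → ¬ ((R · λ _ → 1#) i ≈ 0#)
    -- No nonzero row is supported on two different columns, so `r` is injective, hence onto: row
    -- `i` has a single nonzero entry, and that entry is its sum.
    R·1≉0 i eq with injective⇒surjective r r-injective i
    ... | j , refl = pivot≉0 j (begin
      R (r j) j                     ≈⟨ F.*-identityʳ _ ⟨
      R (r j) j * 1#                ≈⟨ sum-single j _ (λ b b≢j → x*y≈0ˡ 1# (proj₂ (supported j) b b≢j)) ⟨
      sum (λ b → R (r j) b * 1#)    ≈⟨ eq ⟩
      0#                            ∎)

  -- Consequences of nilpotency for rows and diagonal entries.

  AllNilpotent : MatPred n → Set (c ⊔ ℓ)
  AllNilpotent V = ∀ {M} → V M → Nilpotent M

  OnRow : Fin n → Mat n → Set ℓ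
  OnRow i M = ∀ a b → a ≢ i → M a b ≈ 0#

  -- Otherwise each row i carries some nonzero Aᵢ ∈ V. For x as in nonvanishing-vector, scale the Aᵢ
  -- so that ∑ Aᵢ fixes x.
  nil⇒free-row : ∀ {V : MatPred (suc n)} → IsSubspace V → AllNilpotent V →
                 ¬ ¬ (∃[ i ] (∀ {M} → V M → OnRow i M → ∀ b → ¬ ¬ M i b ≈ 0#))
  nil⇒free-row {n} {V} sub nil ¬free =
    ¬¬-all (suc n) {P = λ i → ∃[ M ] (V M × OnRow i M × ∃[ b ] ¬ (M i b ≈ 0#))}
      (λ i none → ¬free (i , λ {M} M∈ on-row b M≉0 → none (M , M∈ , on-row , b , M≉0)))
      -- The goal is a negation, so the finitely many entries of the chosen rows may be taken to be
      -- decidably zero or nonzero.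
      λ A → ¬¬-all (suc n) (λ i → ¬¬-all (suc n) (λ j → ¬¬-excluded-middle)) (contradict A)
    where
    contradict : (A : ∀ i → ∃[ M ] (V M × OnRow i M × ∃[ b ] ¬ (M i b ≈ 0#))) →
                 ¬ (∀ i j → Dec (proj₁ (A i) i j ≈ 0#))
    contradict A dec with nonvanishing-vector n (λ i → proj₁ (A i) i) dec (λ i → proj₂ (proj₂ (proj₂ (A i))))
    ... | x , (i₀ , x≉0) , covers = x≉0 (nilpotent-fixed x (nil S∈) fixed i₀)
      where
      R : Mat (suc n)
      R i = proj₁ (A i) i
      scaled : ∀ i → x i ≈ 0# ⊎ ¬ ((R · x) i ≈ 0#) → ∃[ z ] z * (R · x) i ≈ x i
      scaled i (inj₁ xᵢ≈0) = 0# , F.trans (F.zeroˡ _) (F.sym xᵢ≈0)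
      scaled i (inj₂ Rx≉0) with F.inverse ((R · x) i) Rx≉0
      ... | y , Rx*y≈1 = x i * y , (begin
        x i * y * (R · x) i      ≈⟨ F.*-assoc _ _ _ ⟩
        x i * (y * (R · x) i)    ≈⟨ F.*-congˡ (F.trans (F.*-comm _ _) Rx*y≈1) ⟩
        x i * 1#                 ≈⟨ F.*-identityʳ _ ⟩
        x i                      ∎)
      z : Fin (suc n) → Carrier
      z i = proj₁ (scaled i (covers i))
      S = lincomb z (proj₁ ∘ A)
      S∈ : V S
      S∈ = lincomb∈ sub z (proj₁ ∘ A) (λ i → proj₁ (proj₂ (A i)))
      -- In row `i` of `S` only the summand from `A i` survives, because every other `A t` is
      -- supported on row `t`.
      fixed : ∀ i → (S · x) i ≈ x i
      fixed i = begin
        sum (λ j → S i j * x j)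
          ≈⟨ sum-cong-≋ (λ j → F.*-congʳ {x j} (sum-single i (λ t → z t * proj₁ (A t) i j)
               (λ t t≢i → x*y≈0ʳ (z t) (proj₁ (proj₂ (proj₂ (A t))) i j (t≢i ∘ sym))))) ⟩
        sum (λ j → z i * R i j * x j)
          ≈⟨ sum-cong-≋ (λ j → F.*-assoc (z i) (R i j) (x j)) ⟩
        sum (λ j → z i * (R i j * x j))
          ≈⟨ *-distribˡ-sum (z i) (λ j → R i j * x j) ⟨
        z i * (R · x) i
          ≈⟨ proj₂ (scaled i (covers i)) ⟩
        x i
          ∎

  -- If the diagonal entry had an inverse `y`, then `y M` would fix the `i`-th unit vector.
  nil⇒diagonal≈0 : ∀ {V : MatPred (suc n)} → IsSubspace V → AllNilpotent V → ∀ i {M} → V M →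
                   (∀ a → M (punchIn i a) i ≈ 0#) → ¬ ¬ M i i ≈ 0#
  nil⇒diagonal≈0 sub nil i {M} M∈ column Mᵢᵢ≉0 with F.inverse (M i i) Mᵢᵢ≉0
  ... | y , Mᵢᵢy≈1 = F.1≉0 (begin
    1#      ≈⟨ 1M-diagonal i ⟨
    1M i i  ≈⟨ nilpotent-fixed (λ j → 1M j i) (nil (axpy∈ sub y M∈ (zero∈ sub))) fixed i ⟩
    0#      ∎)
    where
    N : Mat _
    -- The added zero gives `N` the shape for which `axpy∈` yields membership in `V`.
    N a b = y * M a b ⊕ 0#
    column-i : ∀ a → N a i ≈ 1M a i
    column-i = ∀-punchIn i _
      (λ a → F.trans (axpy-zero y (column a) F.refl) (F.sym (1M-off (punchInᵢ≢i i a))))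
      (F.trans (F.+-identityʳ _) (F.trans (F.*-comm _ _) (F.trans Mᵢᵢy≈1 (F.sym (1M-diagonal i)))))
    fixed : ∀ a → (N · λ j → 1M j i) a ≈ 1M a i
    fixed a = begin
      sum (λ j → N a j * 1M j i)    ≈⟨ sum-single i _ (λ j j≢i → x*y≈0ʳ (N a j) (1M-off j≢i)) ⟩
      N a i * 1M i i                ≈⟨ F.*-congˡ (1M-diagonal i) ⟩
      N a i * 1#                    ≈⟨ F.*-identityʳ _ ⟩
      N a i                         ≈⟨ column-i a ⟩
      1M a i                        ∎

  -- The image, up to `≈M`, of the matrices in `V` with zero column `i` under deletion of row and
  -- column `i`. The zero column makes this deletion compatible with powers.
  ColumnFreeMinors : Fin (suc n) → MatPred (suc n) → MatPred n
  ColumnFreeMinors i V N = ∃[ M ] (V M × (∀ a → M a i ≈ 0#) × N ≈M minor i M)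

  columnFreeMinors-isSubspace : ∀ i {V : MatPred (suc n)} → IsSubspace V → IsSubspace (ColumnFreeMinors i V)
  columnFreeMinors-isSubspace i sub = record
    { zero∈ = 0M , zero∈ sub , (λ a → F.refl) , λ a b → F.refl
    ; axpy∈ = λ { x (M , M∈ , M-column , N≈) (M′ , M′∈ , M′-column , N′≈) →
        (λ a b → x * M a b ⊕ M′ a b) , axpy∈ sub x M∈ M′∈
        , (λ a → axpy-zero x (M-column a) (M′-column a))
        , λ a b → F.+-cong (F.*-congˡ (N≈ a b)) (N′≈ a b) }
    }

  columnFreeMinors-nilpotent : ∀ i {V : MatPred (suc n)} → AllNilpotent V → AllNilpotent (ColumnFreeMinors i V)
  columnFreeMinors-nilpotent i nil (M , M∈ , column , N≈) = nilpotent-minor i M _ column N≈ (nil M∈)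

  -- Deletion is injective here: a combination with zero minor and zero column `i` is supported on
  -- row `i`, and `free` forces that row to vanish.
  minor-independent : ∀ i {V : MatPred (suc n)} → IsSubspace V →
                      (∀ {M} → V M → OnRow i M → ∀ b → ¬ ¬ M i b ≈ 0#) →
                      ∀ {d} (B : Fin d → Mat (suc n)) → (∀ t → V (B t)) → (∀ t a → B t a i ≈ 0#) →
                      Independent B → Independent (minor i ∘ B)
  minor-independent i {V} sub free B B∈ column independent cs minors≈0 t cₜ≉0 =
    ¬¬-all _ (free (lincomb∈ sub cs B B∈) on-row)
      λ row≈0 → independent cs (λ a b → ∀-punchIn i (λ a → ∀ b → S a b ≈ 0#) others row≈0 a b) t cₜ≉0
    where
    S = lincomb cs B
    others : ∀ a b → S (punchIn i a) b ≈ 0#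
    others a = ∀-punchIn i _ (minors≈0 a) (sum-zero _ (λ t → x*y≈0ʳ (cs t) (column t (punchIn i a))))
    on-row : OnRow i S
    on-row a b a≢i = subst (λ a → S a b ≈ 0#) (punchIn-punchOut (a≢i ∘ sym)) (others (punchOut (a≢i ∘ sym)) b)

  nil-dimension≤maxAcyclic : ∀ n (G : Digraph n) {V : MatPred n} → IsSubspace V → AllNilpotent V →
                             (∀ {M} → V M → InS G M) → ∀ {d} → IndependentIn V d → d ≤ maxAcyclic n G
  nil-dimension≤maxAcyclic zero G sub nil inS {zero} F = z≤n
  nil-dimension≤maxAcyclic zero G sub nil inS {suc d} (B , B∈ , independent) =
    -- All 0 by 0 matrices are equal to zero, so coefficients 1 contradict independence.
    contradiction F.1≉0 (independent (λ _ → 1#) (λ ()) zero)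
  nil-dimension≤maxAcyclic (suc n) G {V} sub nil inS {d} F =
    -- The inequality of natural numbers is decidable, hence stable, which discharges all the double
    -- negations below.
    decidable-stable (d ≤? maxAcyclic (suc n) G) λ d≰ →
    nil⇒free-row sub nil λ { (i , free) →
    eliminate-entries sub (λ a → punchIn i a , i) (λ a → G (punchIn i a) i) (λ a G-false M∈ → inS M∈ _ _ G-false) F
      λ { (d′ , d≤ , B , B∈ , independent) →
    ¬¬-all d′ (λ t → nil⇒diagonal≈0 sub nil i (proj₁ (B∈ t)) (proj₂ (B∈ t))) λ diagonal →
    let column = λ t → ∀-punchIn i (λ a → B t a i ≈ 0#) (proj₂ (B∈ t)) (diagonal t)
        d′≤ = nil-dimension≤maxAcyclic n (minor i G)
                (columnFreeMinors-isSubspace i sub) (columnFreeMinors-nilpotent i nil)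
                (λ { (M , M∈ , _ , N≈) a b G-false → F.trans (N≈ a b) (inS M∈ _ _ G-false) })
                ( minor i ∘ B
                , (λ t → B t , proj₁ (B∈ t) , column t , λ a b → F.refl)
                , minor-independent i sub free B (proj₁ ∘ B∈) column independent )
    in d≰ (ℕₚ.≤-trans d≤ (ℕₚ.≤-trans (ℕₚ.+-monoʳ-≤ (indegree i G) d′≤) (indegree+maxAcyclic-minor≤ G i))) } }

  -- Spans and the upper bound.

  Span : ∀ {d} → (Fin d → Mat n) → MatPred n
  Span B M = ∃[ cs ] M ≈M lincomb cs B

  span-isSubspace : ∀ {d} (B : Fin d → Mat n) → IsSubspace (Span B)
  span-isSubspace B = record
    { zero∈ = (λ _ → 0#) , λ i j → F.sym (sum-zero _ (λ t → F.zeroˡ (B t i j)))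
    ; axpy∈ = λ { x {M} {N} (cs , M≈) (cs′ , N≈) → (λ t → x * cs t ⊕ cs′ t) , λ i j → begin
        x * M i j ⊕ N i j
          ≈⟨ F.+-cong (F.*-congˡ (M≈ i j)) (N≈ i j) ⟩
        x * lincomb cs B i j ⊕ lincomb cs′ B i j
          ≈⟨ F.+-congʳ (*-distribˡ-sum x (λ t → cs t * B t i j)) ⟩
        sum (λ t → x * (cs t * B t i j)) ⊕ lincomb cs′ B i j
          ≈⟨ ∑-distrib-+ (λ t → x * (cs t * B t i j)) (λ t → cs′ t * B t i j) ⟨
        sum (λ t → x * (cs t * B t i j) ⊕ cs′ t * B t i j)
          ≈⟨ sum-cong-≋ (λ t → F.trans (F.distribʳ (B t i j) (x * cs t) (cs′ t)) (F.+-congʳ (F.*-assoc x (cs t) (B t i j)))) ⟨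
        sum (λ t → (x * cs t ⊕ cs′ t) * B t i j)
          ∎ }
    }

  power-cong : ∀ {M N : Mat n} → M ≈M N → ∀ k → (M ^M k) ≈M (N ^M k)
  power-cong M≈N zero    i j = F.refl
  power-cong M≈N (suc k) i j = sum-cong-≋ (λ l → F.*-cong (M≈N i l) (power-cong M≈N k l j))

  nilSubspaceDim≤maxAcyclic : ∀ n (G : Digraph n) d → NilSubspaceDim G d → d ≤ maxAcyclic n G
  nilSubspaceDim≤maxAcyclic n G d (B , inS , independent , nil) =
    nil-dimension≤maxAcyclic n G {Span B} (span-isSubspace B)
      (λ { (cs , M≈) → proj₁ (nil cs) , λ i j → F.trans (power-cong M≈ (proj₁ (nil cs)) i j) (proj₂ (nil cs) i j) })
      (λ { (cs , M≈) i j G-false →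
        F.trans (M≈ i j) (sum-zero _ (λ t → x*y≈0ʳ (cs t) (inS t i j G-false))) })
      (B , (λ t → 1M t , λ i j → F.sym (unit-lincomb t i j)) , λ cs cs·B≈0 t cₜ≉0 → cₜ≉0 (independent cs cs·B≈0 t))
    where
    unit-lincomb : ∀ t i j → lincomb (1M t) B i j ≈ B t i j
    unit-lincomb t i j = begin
      sum (λ s → 1M t s * B s i j)  ≈⟨ sum-single t _ (λ s s≢t → x*y≈0ˡ (B s i j) (1M-off (s≢t ∘ sym))) ⟩
      1M t t * B t i j              ≈⟨ F.*-congʳ (1M-diagonal t) ⟩
      1# * B t i j                  ≈⟨ F.*-identityˡ _ ⟩
      B t i j                       ∎

  -- Elementary matrices and the lower bound.

  elementary : Fin n × Fin n → Mat n
  elementary (p , q) i j = 1M i p * 1M j q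

  elementary-on : ∀ (e : Fin n × Fin n) → uncurry (elementary e) e ≈ 1#
  elementary-on (p , q) = F.trans (F.*-cong (1M-diagonal p) (1M-diagonal q)) (F.*-identityˡ 1#)

  elementary-off : ∀ {e i j} → e ≢ (i , j) → elementary {n} e i j ≈ 0#
  elementary-off {e = p , q} {i} {j} e≢ with i ≟ p
  ... | no _     = F.zeroˡ _
  ... | yes refl = F.trans (F.*-identityˡ _) (1M-off (e≢ ∘ cong (i ,_) ∘ sym))

  -- Evaluating the combination at position `e t` isolates `cs t`, since the other matrices have
  -- their 1 elsewhere.
  elementary-independent : ∀ {d} (e : Fin d → Fin n × Fin n) → Injective _≡_ _≡_ e →
                           LinearlyIndependent (elementary ∘ e)
  elementary-independent e inj cs sum≈0 t = begin
    cs t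
      ≈⟨ F.*-identityʳ _ ⟨
    cs t * 1#
      ≈⟨ F.*-congˡ (elementary-on (e t)) ⟨
    cs t * uncurry (elementary (e t)) (e t)
      ≈⟨ sum-single t (λ s → cs s * uncurry (elementary (e s)) (e t))
           (λ s s≢t → x*y≈0ʳ (cs s) (elementary-off (s≢t ∘ inj))) ⟨
    uncurry (lincomb cs (elementary ∘ e)) (e t)
      ≈⟨ uncurry sum≈0 (e t) ⟩
    0#
      ∎

  module _ (G : Digraph n) (f : Fin n → ℕ) where
    private H = descending f G

    -- Entry `(i , j)` of the power sums over walks of length `k` from `i`. The height drops along
    -- each arc, so a walk of more than `f i` arcs is impossible.
    descending-power≈0 : ∀ {M : Mat n} → InS H M → ∀ k i j → f i < k → (M ^M k) i j ≈ 0#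
    descending-power≈0 {M} inS (suc k) i j fi≤k = sum-zero _ (λ l → term l (H i l) refl)
      where
      term : ∀ l b → H i l ≡ b → M i l * (M ^M k) l j ≈ 0#
      term l false arc = x*y≈0ˡ _ (inS i l arc)
      term l true  arc = x*y≈0ʳ _ (descending-power≈0 inS k l j (ℕₚ.≤-trans (descending-< f G i l arc) (ℕₚ.≤-pred fi≤k)))

    descending-nilpotent : ∀ {M : Mat n} → InS H M → Nilpotent M
    -- The sum of all heights bounds each height, which gives one exponent for every row.
    descending-nilpotent inS = suc (sumℕ f) , λ i j → descending-power≈0 inS _ i j (s≤s (term≤sumℕ f i))
      where
      term≤sumℕ : ∀ {k} (g : Fin k → ℕ) i → g i ≤ sumℕ g
      term≤sumℕ g zero    = ℕₚ.m≤m+n _ _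
      term≤sumℕ g (suc i) = ℕₚ.≤-trans (term≤sumℕ (g ∘ suc) i) (ℕₚ.m≤n+m _ (g zero))

    -- The elementary matrices of the arcs of `H` serve as basis: their combinations remain
    -- supported on `H`, hence nilpotent.
    descending-nilSubspaceDim : NilSubspaceDim G (arcCount H)
    descending-nilSubspaceDim with arcs H
    ... | e , inj , e-arc =
      elementary ∘ e
      , (λ t i j G-false → inH t i j (cong (_∧ (f j <ᵇ f i)) G-false))
      , elementary-independent e inj
      , λ cs → descending-nilpotent (λ i j H-false → sum-zero _ (λ t → x*y≈0ʳ (cs t) (inH t i j H-false)))
      where
      inH : ∀ t → InS H (elementary (e t))
      inH t i j H-false = elementary-off (λ eq → Boolₚ.not-¬ (trans (sym (cong (uncurry H) eq)) (e-arc t)) H-false)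

  maxAcyclic-nilSubspaceDim-maximum : ∀ n (G : Digraph n) → IsMaximum (NilSubspaceDim G) (maxAcyclic n G)
  maxAcyclic-nilSubspaceDim-maximum n G with maxAcyclic-attained n G
  ... | f , size = subst (NilSubspaceDim G) size (descending-nilSubspaceDim G f) , nilSubspaceDim≤maxAcyclic n G

theorem1p9 : ∀ {c ℓ} (𝔽 : Field c ℓ) (n : ℕ) (G : Digraph n) →
    ∃[ m ] (IsMaximum (AcyclicSpanningSize G) m ×
    IsMaximum (Matrices.NilSubspaceDim 𝔽 G) m)
theorem1p9 𝔽 n G = maxAcyclic n G , maxAcyclic-maximum n G , NilSubspaces.maxAcyclic-nilSubspaceDim-maximum 𝔽 n G
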